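{- For $i=1,2$ let $C_i$ be a signature, $c_i\in C_i^k$ a $k$-ary connective (same $k$ for both), and $M_i=(\mathbf A_i,D_i)$ a $C_i$-matrix with universe $A_i$. Let $\lambda:A_1\to A_2$ and $\mu:A_2\to A_1$ be functions such that: (a) $(\lambda,\mu)$ is an admissible pair; (b) $\lambda$ is an isomorphism from $\mathbf A_1/c_1$ to $\mathbf A_2/c_2$, i.e. $\lambda$ is a bijection and $\lambda(c_1^{\mathbf A_1}(x_1,\dots,x_k))=c_2^{\mathbf A_2}(\lambda(x_1),\dots,\lambda(x_k))$ for all $x_1,\dots,x_k\in A_1$; (c) $\mu=\lambda^{ -1}$. Then $(\lambda,\mu)$ identifies $c_1$ with $c_2$: for every pair of $(c_1,c_2)$-associated formulas $\varphi_1,\varphi_2\in L(C_\circledast)$ with variables among $p_1,\dots,p_m$ and every $\vec a\in (A_\circledast)^m$, $\varphi_1(\vec a)\in D_\circledast$ if and only if $\varphi_2(\vec a)\in D_\circledast$, where $\varphi_j(\vec a)$ is the value of $\varphi_j$ at $\vec a$ in the algebra of the fibred matrix $(M_1\circledast M_2)_{(\lambda,\mu)}$.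
   Context: Fix a countable set $\mathcal V=\{p_1,p_2,\dots\}$ of propositional variables. A signature $C=\{C^k\}_{k\in\mathbb N}$ is a family of pairwise disjoint sets, disjoint from $\mathcal V$ ($C^k$ is the set of $k$-ary connectives); $L(C)$ is the absolutely free algebra over $C$ generated by $\mathcal V$. A $C$-matrix is $M=(\mathbf A,D)$ with $\mathbf A$ a $C$-algebra with universe $A$ and $D\subseteq A$. For a connective $c$, $\mathbf A/c$ is the algebra with universe $A$ whose only operation is $c^{\mathbf A}$. A pair $(\lambda,\mu)$ with $\lambda:A_1\to A_2$, $\mu:A_2\to A_1$ is admissible if for every $x\in A_1$: $\lambda(x)\in D_2$ iff $x\in D_1$; and for every $y\in A_2$: $\mu(y)\in D_1$ iff $y\in D_2$. Put $C_\circledast=C_1\uplus C_2$, $A_\circledast=A_1\uplus A_2$, $D_\circledast=D_1\uplus D_2$ (disjoint unions). Define $\ast_\lambda:A_\circledast\to A_2$ by $\ast_\lambda(x)=\lambda(x)$ if $x\in A_1$, $\ast_\lambda(x)=x$ if $x\in A_2$; and $\ast_\mu:A_\circledast\to A_1$ by $\ast_\mu(x)=x$ if $x\in A_1$, $\ast_\mu(x)=\mu(x)$ if $x\in A_2$. The fibred $C_\circledast$-matrix $(M_1\circledast M_2)_{(\lambda,\mu)}$ has universe $A_\circledast$, designated set $D_\circledast$, and operations $c(x_1,\dots,x_r)=c^{\mathbf A_1}(\ast_\mu(x_1),\dots,\ast_\mu(x_r))$ for $c\in C_1^r$ and $c(x_1,\dots,x_r)=c^{\mathbf A_2}(\ast_\lambda(x_1),\dots,\ast_\lambda(x_r))$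 for $c\in C_2^r$. Two formulas $\varphi_1,\varphi_2$ are closely $(c_1,c_2)$-associated if $\varphi_1=\varphi_2$, or $\varphi_2$ results from $\varphi_1$ by replacing exactly one occurrence of $c_1$ by $c_2$, or $\varphi_2$ results from $\varphi_1$ by replacing exactly one occurrence of $c_2$ by $c_1$. They are $(c_1,c_2)$-associated if there is a finite sequence $\psi_0,\dots,\psi_r$ of formulas with $\psi_0=\varphi_1$, $\psi_r=\varphi_2$ and $\psi_{j-1}$ closely $(c_1,c_2)$-associated to $\psi_j$ for $j=1,\dots,r$. -}

module Defs where

open import Level using (Level; _⊔_; 0ℓ) renaming (suc to lsuc)
open import Data.Nat.Base using (ℕ; _<_)
open import Data.Fin.Base using (fromℕ<)
open import Data.Product.Base using (_×_)
open import Data.Sum.Base using (_⊎_; inj₁; inj₂; [_,_])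
open import Data.Vec.Base using (Vec; []; _∷_; map; lookup)
open import Data.Vec.Relation.Unary.All using (All; []; _∷_)
open import Function.Base using (id)
open import Function.Bundles using (_⇔_)
open import Function.Definitions using (Bijective)
open import Relation.Binary.Construct.Closure.ReflexiveTransitive using (Star)
open import Relation.Binary.PropositionalEquality.Core using (_≡_)
open import Relation.Unary using (Pred; _⟨⊎⟩_)

private
  variable
    o o₁ o₂ a b d : Level
    k m r : ℕ

-- Indexing by arity makes the sets of connectives of different arities
-- disjoint by typing.
Signature : ∀ o → Set (lsuc o)
Signature o = ℕ → Set o

-- L(C).  The propositional variable p₁ is `var 0`, p₂ is `var 1`, etc.
data Formula (C : Signature o) : Set o where
  var : ℕ → Formula C
  app : ∀ {r} → C r → Vec (Formula C) r → Formula C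

-- The variables of the formula are among p₁, …, pₘ.
data VarsAmong {C : Signature o} (m : ℕ) : Formula C → Set o where
  var : ∀ {i} → i < m → VarsAmong m (var i)
  app : ∀ {r} {c : C r} {φs} → All (VarsAmong m) φs → VarsAmong m (app c φs)

-- Operations act on `Vec`, not on functions out of `Fin r`: without
-- function extensionality the latter need not respect pointwise equality
-- of the arguments.
record Algebra (C : Signature o) (a : Level) : Set (o ⊔ lsuc a) where
  field
    Carrier : Set a
    ⟦_⟧     : ∀ {r} → C r → Vec Carrier r → Carrier

record Matrix (C : Signature o) (a d : Level) : Set (o ⊔ lsuc (a ⊔ d)) where
  field
    algebra    : Algebra C a
    Designated : Pred (Algebra.Carrier algebra) d
  open Algebra algebra public

module _ {C : Signature o} (𝐀 : Algebra C a) where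
  open Algebra 𝐀

  eval    : Vec Carrier m → (φ : Formula C) → VarsAmong m φ → Carrier
  evalAll : Vec Carrier m → (φs : Vec (Formula C) r) → All (VarsAmong m) φs →
            Vec Carrier r

  eval as (var i)    (var i<m) = lookup as (fromℕ< i<m)
  eval as (app c φs) (app vs)  = ⟦ c ⟧ (evalAll as φs vs)

  evalAll as []       []       = []
  evalAll as (φ ∷ φs) (v ∷ vs) = eval as φ v ∷ evalAll as φs vs

record IsIsomorphism {C : Signature o} (𝐀 : Algebra C a) (𝐁 : Algebra C b)
                     (h : Algebra.Carrier 𝐀 → Algebra.Carrier 𝐁) :
                     Set (o ⊔ a ⊔ b) where
  private
    module A = Algebra 𝐀
    module B = Algebra 𝐁
  field
    bijective : Bijective _≡_ _≡_ h
    homo      : ∀ {r} (c : C r) (xs : Vec A.Carrier r) →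
                h (A.⟦ c ⟧ xs) ≡ B.⟦ c ⟧ (map h xs)

data Single (k : ℕ) : Signature 0ℓ where
  • : Single k k

-- 𝐀 / c is an algebra over a signature that depends only on the arity of c,
-- so that 𝐀₁ / c₁ and 𝐀₂ / c₂ are similar algebras.
_/_ : {C : Signature o} → Algebra C a → C k → Algebra (Single k) a
𝐀 / c = record
  { Carrier = Algebra.Carrier 𝐀
  ; ⟦_⟧     = λ { • → Algebra.⟦_⟧ 𝐀 c }
  }

_⊎ˢ_ : Signature o₁ → Signature o₂ → Signature (o₁ ⊔ o₂)
(C₁ ⊎ˢ C₂) r = C₁ r ⊎ C₂ r

module _ {C₁ : Signature o₁} {C₂ : Signature o₂}
         (M₁ : Matrix C₁ a d) (M₂ : Matrix C₂ b d)
         (λ′ : Matrix.Carrier M₁ → Matrix.Carrier M₂)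
         (μ : Matrix.Carrier M₂ → Matrix.Carrier M₁) where
  private
    module M₁ = Matrix M₁
    module M₂ = Matrix M₂

  Admissible : Set (a ⊔ b ⊔ d)
  Admissible = (∀ x → M₂.Designated (λ′ x) ⇔ M₁.Designated x)
             × (∀ y → M₁.Designated (μ y) ⇔ M₂.Designated y)

  ∗λ : M₁.Carrier ⊎ M₂.Carrier → M₂.Carrier
  ∗λ = [ λ′ , id ]

  ∗μ : M₁.Carrier ⊎ M₂.Carrier → M₁.Carrier
  ∗μ = [ id , μ ]

  fibredOp : (C₁ ⊎ˢ C₂) r → Vec (M₁.Carrier ⊎ M₂.Carrier) r →
             M₁.Carrier ⊎ M₂.Carrier
  fibredOp (inj₁ c) xs = inj₁ (M₁.⟦ c ⟧ (map ∗μ xs))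
  fibredOp (inj₂ c) xs = inj₂ (M₂.⟦ c ⟧ (map ∗λ xs))

  fibred : Matrix (C₁ ⊎ˢ C₂) (a ⊔ b) d
  fibred = record
    { algebra    = record { Carrier = M₁.Carrier ⊎ M₂.Carrier ; ⟦_⟧ = fibredOp }
    ; Designated = M₁.Designated ⟨⊎⟩ M₂.Designated
    }

-- `Replace c c′ φ ψ`: ψ results from φ by replacing exactly one occurrence
-- of c by c′; `ReplaceIn` is the same for a vector of formulas.
module _ {C : Signature o} {k : ℕ} (c c′ : C k) where
  mutual
    data Replace : Formula C → Formula C → Set o where
      here  : ∀ {φs} → Replace (app c φs) (app c′ φs)
      below : ∀ {r} {e : C r} {φs ψs} →
              ReplaceIn φs ψs → Replace (app e φs) (app e ψs)

    data ReplaceIn : ∀ {r} → Vec (Formula C) r → Vec (Formula C) r → Set o where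
      head : ∀ {r φ ψ} {φs : Vec (Formula C) r} →
             Replace φ ψ → ReplaceIn (φ ∷ φs) (ψ ∷ φs)
      tail : ∀ {r φ} {φs ψs : Vec (Formula C) r} →
             ReplaceIn φs ψs → ReplaceIn (φ ∷ φs) (φ ∷ ψs)

CloselyAssociated : {C : Signature o} → C k → C k → Formula C → Formula C → Set o
CloselyAssociated c c′ φ ψ = φ ≡ ψ ⊎ Replace c c′ φ ψ ⊎ Replace c′ c φ ψ

Associated : {C : Signature o} → C k → C k → Formula C → Formula C → Set o
Associated c c′ = Star (CloselyAssociated c c′)

module _ {C₁ : Signature o₁} {C₂ : Signature o₂}
         (M₁ : Matrix C₁ a d) (M₂ : Matrix C₂ b d)
         (λ′ : Matrix.Carrier M₁ → Matrix.Carrier M₂)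
         (μ : Matrix.Carrier M₂ → Matrix.Carrier M₁) where

  Identifies : C₁ k → C₂ k → Set (o₁ ⊔ o₂ ⊔ a ⊔ b ⊔ d)
  Identifies c₁ c₂ =
    ∀ (φ₁ φ₂ : Formula (C₁ ⊎ˢ C₂)) → Associated (inj₁ c₁) (inj₂ c₂) φ₁ φ₂ →
    ∀ (m : ℕ) (v₁ : VarsAmong m φ₁) (v₂ : VarsAmong m φ₂) (as : Vec M.Carrier m) →
    M.Designated (eval M.algebra as φ₁ v₁) ⇔ M.Designated (eval M.algebra as φ₂ v₂)
    where module M = Matrix (fibred M₁ M₂ λ′ μ)

{-# OPTIONS --safe #-}
module Submission where

-- The idea: reading every element of A₁ ⊎ A₂ in A₂ along ∗λ is invisible to
-- the fibred matrix. Since μ = λ⁻¹, ∗μ factors as μ ∘ ∗λ, so every operation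
-- depends on its arguments only through ∗λ; by admissibility so does
-- designation; and since λ is an isomorphism of 𝐀₁/c₁ onto 𝐀₂/c₂, the two
-- connectives agree after ∗λ. Hence replacing one by the other anywhere in a
-- formula does not change the ∗λ-image of its value.

open import Defs
open import Level using (Level)
open import Data.Nat.Base using (ℕ)
open import Data.Nat.Properties using (<-irrelevant)
open import Data.Product.Base using (_,_; proj₁; proj₂)
open import Data.Sum.Base using (inj₁; inj₂)
open import Data.Vec.Base using (Vec; []; _∷_; map)
open import Data.Vec.Properties using (map-cong; map-∘)
open import Data.Vec.Relation.Unary.All using (All; []; _∷_)
open import Function.Base using (_∘_)
open import Function.Bundles using (_⇔_; mk⇔; Equivalence)
open import Function.Definitions using (Inverseᵇ)
open import Function.Properties.Equivalence using (⇔-isEquivalence)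
open import Relation.Binary.Construct.Closure.ReflexiveTransitive using (ε; _◅_)
open import Relation.Binary.PropositionalEquality.Core
  using (_≡_; refl; sym; trans; cong; cong₂; subst)
open import Relation.Binary.PropositionalEquality.Properties using (module ≡-Reasoning)
open import Relation.Binary.Structures using (IsEquivalence)

private
  variable
    o a b : Level
    C : Signature o
    k m r : ℕ

-- `eval` takes the variable bound as an argument, and `Identifies` quantifies over both bounds
-- independently. Values must therefore not depend on which bound is supplied.
VarsAmong-irrelevant : {φ : Formula C} (v w : VarsAmong m φ) → v ≡ w
AllVarsAmong-irrelevant : {φs : Vec (Formula C) r}
                          (vs ws : All (VarsAmong m) φs) → vs ≡ ws

VarsAmong-irrelevant (var p)  (var q)  = cong var (<-irrelevant p q)
VarsAmong-irrelevant (app vs) (app ws) = cong app (AllVarsAmong-irrelevant vs ws)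

AllVarsAmong-irrelevant []       []       = refl
AllVarsAmong-irrelevant (v ∷ vs) (w ∷ ws) =
  cong₂ _∷_ (VarsAmong-irrelevant v w) (AllVarsAmong-irrelevant vs ws)

module _ {c c′ : C k} where

  Replace-VarsAmong : ∀ {φ ψ} → Replace c c′ φ ψ → VarsAmong m φ → VarsAmong m ψ
  ReplaceIn-VarsAmong : {φs ψs : Vec (Formula C) r} → ReplaceIn c c′ φs ψs →
                        All (VarsAmong m) φs → All (VarsAmong m) ψs

  Replace-VarsAmong here       (app vs) = app vs
  Replace-VarsAmong (below ρs) (app vs) = app (ReplaceIn-VarsAmong ρs vs)

  ReplaceIn-VarsAmong (head ρ)  (v ∷ vs) = Replace-VarsAmong ρ v ∷ vs
  ReplaceIn-VarsAmong (tail ρs) (v ∷ vs) = v ∷ ReplaceIn-VarsAmong ρs vs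

-- `Identifies` bounds the variables of the two end formulas only. This carries the bound along the
-- chain, so that the formulas in between can be evaluated too.
CloselyAssociated-VarsAmong : {c c′ : C k} {φ ψ : Formula C} → CloselyAssociated c c′ φ ψ →
                              VarsAmong m φ → VarsAmong m ψ
CloselyAssociated-VarsAmong (inj₁ refl)     v = v
CloselyAssociated-VarsAmong (inj₂ (inj₁ ρ)) v = Replace-VarsAmong ρ v
CloselyAssociated-VarsAmong (inj₂ (inj₂ ρ)) v = Replace-VarsAmong ρ v

module _ (𝐀 : Algebra C a) {B : Set b} (h : Algebra.Carrier 𝐀 → B) where
  open Algebra 𝐀

  -- `B` is a bare set: compatibility with the operations is put on the relation `h x ≡ h y` alone,
  -- with no algebra structure on the target.
  KernelIsCongruence : Set _
  KernelIsCongruence = ∀ {r} (e : C r) {xs ys : Vec Carrier r} →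
                       map h xs ≡ map h ys → h (⟦ e ⟧ xs) ≡ h (⟦ e ⟧ ys)

  AgreeUpTo : C k → C k → Set _
  AgreeUpTo c c′ = ∀ xs → h (⟦ c ⟧ xs) ≡ h (⟦ c′ ⟧ xs)

module _ (𝐀 : Algebra C a) {B : Set b} (h : Algebra.Carrier 𝐀 → B)
         (h-cong : KernelIsCongruence 𝐀 h) (as : Vec (Algebra.Carrier 𝐀) m) where

  module _ {c c′ : C k} (c≈c′ : AgreeUpTo 𝐀 h c c′) where

    -- Induction along the path to the replaced occurrence: at the occurrence the connectives agree
    -- under `h`, and `h-cong` passes the equality up through each enclosing connective.
    eval-Replace : ∀ {φ ψ} → Replace c c′ φ ψ →
                   (v : VarsAmong m φ) (w : VarsAmong m ψ) →
                   h (eval 𝐀 as φ v) ≡ h (eval 𝐀 as ψ w)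
    evalAll-ReplaceIn : {φs ψs : Vec (Formula C) r} → ReplaceIn c c′ φs ψs →
                        (vs : All (VarsAmong m) φs) (ws : All (VarsAmong m) ψs) →
                        map h (evalAll 𝐀 as φs vs) ≡ map h (evalAll 𝐀 as ψs ws)

    -- Both sides have the same argument formulas, but possibly different bounds; identifying the
    -- bounds makes the argument values the same vector.
    eval-Replace here (app vs) (app ws)
      rewrite AllVarsAmong-irrelevant vs ws = c≈c′ _
    eval-Replace (below ρs) (app vs) (app ws) = h-cong _ (evalAll-ReplaceIn ρs vs ws)

    evalAll-ReplaceIn (head ρ) (v ∷ vs) (w ∷ ws)
      rewrite AllVarsAmong-irrelevant vs ws =
      cong (_∷ map h (evalAll 𝐀 as _ ws)) (eval-Replace ρ v w)
    evalAll-ReplaceIn (tail ρs) (v ∷ vs) (w ∷ ws)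
      rewrite VarsAmong-irrelevant v w =
      cong (h (eval 𝐀 as _ w) ∷_) (evalAll-ReplaceIn ρs vs ws)

  module _ {c c′ : C k} (c≈c′ : AgreeUpTo 𝐀 h c c′) where

    eval-CloselyAssociated : ∀ {φ ψ} → CloselyAssociated c c′ φ ψ →
                             (v : VarsAmong m φ) (w : VarsAmong m ψ) →
                             h (eval 𝐀 as φ v) ≡ h (eval 𝐀 as ψ w)
    eval-CloselyAssociated (inj₁ refl) v w rewrite VarsAmong-irrelevant v w = refl
    eval-CloselyAssociated (inj₂ (inj₁ ρ)) v w = eval-Replace c≈c′ ρ v w
    eval-CloselyAssociated (inj₂ (inj₂ ρ)) v w = eval-Replace (sym ∘ c≈c′) ρ v w

    eval-Associated : ∀ {φ ψ} → Associated c c′ φ ψ →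
                      (v : VarsAmong m φ) (w : VarsAmong m ψ) →
                      h (eval 𝐀 as φ v) ≡ h (eval 𝐀 as ψ w)
    -- The formulas coincide but `v` and `w` may not, so the empty chain is treated as one trivial
    -- link.
    eval-Associated ε        v w = eval-CloselyAssociated (inj₁ refl) v w
    eval-Associated (γ ◅ γs) v w =
      trans (eval-CloselyAssociated γ v u) (eval-Associated γs u w)
      where u = CloselyAssociated-VarsAmong {c = c} {c′} γ v

module _ {o₁ o₂ a b d} {C₁ : Signature o₁} {C₂ : Signature o₂}
         (M₁ : Matrix C₁ a d) (M₂ : Matrix C₂ b d)
         (λ′ : Matrix.Carrier M₁ → Matrix.Carrier M₂)
         (μ : Matrix.Carrier M₂ → Matrix.Carrier M₁) where
  private
    module M₁ = Matrix M₁
    module M₂ = Matrix M₂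
    module M  = Matrix (fibred M₁ M₂ λ′ μ)
    toλ = ∗λ M₁ M₂ λ′ μ
    toμ = ∗μ M₁ M₂ λ′ μ

  -- On A₁ this is the admissibility condition on λ; on A₂ the map `∗λ` is the identity.
  Designated-∗λ : Admissible M₁ M₂ λ′ μ → ∀ x → M.Designated x ⇔ M₂.Designated (toλ x)
  Designated-∗λ (λ-adm , _) (inj₁ x) = IsEquivalence.sym ⇔-isEquivalence (λ-adm x)
  Designated-∗λ _           (inj₂ y) = IsEquivalence.refl ⇔-isEquivalence

  Designated-resp-∗λ : Admissible M₁ M₂ λ′ μ → ∀ x y → toλ x ≡ toλ y →
                       M.Designated x ⇔ M.Designated y
  Designated-resp-∗λ adm x y eq = mk⇔
    (Y.from ∘ subst M₂.Designated eq ∘ X.to)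
    (X.from ∘ subst M₂.Designated (sym eq) ∘ Y.to)
    where
    module X = Equivalence (Designated-∗λ adm x)
    module Y = Equivalence (Designated-∗λ adm y)

  module _ (inv : Inverseᵇ _≡_ _≡_ λ′ μ) where
    open ≡-Reasoning

    -- On A₁ this says that μ ∘ λ is the identity; on A₂ both sides are μ.
    ∗μ≗μ∘∗λ : ∀ x → toμ x ≡ μ (toλ x)
    ∗μ≗μ∘∗λ (inj₁ x) = sym (proj₂ inv refl)
    ∗μ≗μ∘∗λ (inj₂ y) = refl

    λ∘∗μ≗∗λ : ∀ x → λ′ (toμ x) ≡ toλ x
    λ∘∗μ≗∗λ (inj₁ x) = refl
    λ∘∗μ≗∗λ (inj₂ y) = proj₁ inv refl

    ∗λ-kernelIsCongruence : KernelIsCongruence M.algebra toλ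
    ∗λ-kernelIsCongruence (inj₁ c) {xs} {ys} eq = cong (λ′ ∘ M₁.⟦ c ⟧) (begin
      map toμ xs            ≡⟨ map-cong ∗μ≗μ∘∗λ xs ⟩
      map (μ ∘ toλ) xs      ≡⟨ map-∘ μ toλ xs ⟩
      map μ (map toλ xs)    ≡⟨ cong (map μ) eq ⟩
      map μ (map toλ ys)    ≡⟨ map-∘ μ toλ ys ⟨
      map (μ ∘ toλ) ys      ≡⟨ map-cong ∗μ≗μ∘∗λ ys ⟨
      map toμ ys            ∎)
    -- A connective of C₂ already reads its arguments through `∗λ`, so `eq` equates the very vectors
    -- it is applied to.
    ∗λ-kernelIsCongruence (inj₂ c) eq = cong M₂.⟦ c ⟧ eq

    ∗λ-agree : ∀ {c₁ : C₁ k} {c₂ : C₂ k} →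
               IsIsomorphism (M₁.algebra / c₁) (M₂.algebra / c₂) λ′ →
               AgreeUpTo M.algebra toλ (inj₁ c₁) (inj₂ c₂)
    ∗λ-agree {c₁ = c₁} {c₂} iso xs = begin
      -- The isomorphism moves λ inside `c₁`, turning it into `c₂`; the arguments become λ ∘ `∗μ`,
      -- which is `∗λ`, the reading that the fibred `c₂` uses.
      λ′ (M₁.⟦ c₁ ⟧ (map toμ xs))      ≡⟨ IsIsomorphism.homo iso • (map toμ xs) ⟩
      M₂.⟦ c₂ ⟧ (map λ′ (map toμ xs))  ≡⟨ cong M₂.⟦ c₂ ⟧ (map-∘ λ′ toμ xs) ⟨
      M₂.⟦ c₂ ⟧ (map (λ′ ∘ toμ) xs)    ≡⟨ cong M₂.⟦ c₂ ⟧ (map-cong λ∘∗μ≗∗λ xs) ⟩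
      M₂.⟦ c₂ ⟧ (map toλ xs)           ∎

theorem4p9 : ∀ {o₁ o₂ a b d} {C₁ : Signature o₁} {C₂ : Signature o₂}
    (k : ℕ) (c₁ : C₁ k) (c₂ : C₂ k)
    (M₁ : Matrix C₁ a d) (M₂ : Matrix C₂ b d)
    (λ′ : Matrix.Carrier M₁ → Matrix.Carrier M₂)
    (μ : Matrix.Carrier M₂ → Matrix.Carrier M₁) →
    Admissible M₁ M₂ λ′ μ →
    IsIsomorphism (Matrix.algebra M₁ / c₁) (Matrix.algebra M₂ / c₂) λ′ →
    Inverseᵇ _≡_ _≡_ λ′ μ →
    Identifies M₁ M₂ λ′ μ c₁ c₂
theorem4p9 k c₁ c₂ M₁ M₂ λ′ μ adm iso inv φ₁ φ₂ assoc m v₁ v₂ as =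
  Designated-resp-∗λ M₁ M₂ λ′ μ adm (eval M.algebra as φ₁ v₁) (eval M.algebra as φ₂ v₂)
    (eval-Associated M.algebra (∗λ M₁ M₂ λ′ μ) (∗λ-kernelIsCongruence M₁ M₂ λ′ μ inv) as
                     (∗λ-agree M₁ M₂ λ′ μ inv iso) assoc v₁ v₂)
  where module M = Matrix (fibred M₁ M₂ λ′ μ)
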